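{- Let $G=(V,E)$ be a graph of minimum degree $\delta\geq 2$ and maximum degree $\Delta$. Then $$\chi'_{\subset}(G)\leq 3\Delta-1.$$
   Context: All graphs are simple and finite. For an edge colouring $c\colon E\to C$ of a graph $G=(V,E)$, the palette of a vertex $v$ is $S_c(v)=\{c(uv): u\in N(v)\}$. The colouring $c$ is inclusion-free if it is proper (adjacent edges receive distinct colours) and for every edge $uv\in E$ we have $S_c(u)\not\subseteq S_c(v)$ and $S_c(v)\not\subseteq S_c(u)$. The inclusion chromatic index $\chi'_{\subset}(G)$ is the least number of colours in an inclusion-free colouring of $G$. -}

module Defs where

open import Data.Nat using (ℕ; _≤_)
open import Data.Fin using (Fin)
open import Data.Fin.Subset using (Subset; ∣_∣)
open import Data.Vec using (tabulate)
open import Data.Bool using (Bool; T)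
open import Data.Product using (Σ; ∃; ∃-syntax; _×_)
open import Relation.Nullary using (¬_)
open import Relation.Binary.PropositionalEquality using (_≡_; _≢_)

record Graph : Set where
  field
    n      : ℕ
    adj    : Fin n → Fin n → Bool
    sym    : ∀ u v → adj u v ≡ adj v u
    irrefl : ∀ v → adj v v ≡ Bool.false
open Graph public

module _ (G : Graph) where

  Adj : Fin (n G) → Fin (n G) → Set
  Adj u v = T (adj G u v)

  neighbourhood : Fin (n G) → Subset (n G)
  neighbourhood v = tabulate (adj G v)

  deg : Fin (n G) → ℕ
  deg v = ∣ neighbourhood v ∣

  MinDegree : ℕ → Set
  MinDegree δ = (∀ v → δ ≤ deg v) × ∃[ v ] deg v ≡ δ

  MaxDegree : ℕ → Set
  MaxDegree Δ = (∀ v → deg v ≤ Δ) × ∃[ v ] deg v ≡ Δ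

  record EdgeColouring (k : ℕ) : Set where
    field
      col     : ∀ u v → Adj u v → Fin k
      col-sym : ∀ u v (p : Adj u v) (q : Adj v u) → col u v p ≡ col v u q
  open EdgeColouring public

  module _ {k : ℕ} (c : EdgeColouring k) where

    InPalette : Fin (n G) → Fin k → Set
    InPalette v a = ∃[ u ] Σ (Adj v u) (λ p → col c v u p ≡ a)

    PaletteSubset : Fin (n G) → Fin (n G) → Set
    PaletteSubset u v = ∀ a → InPalette u a → InPalette v a

    Proper : Set
    Proper = ∀ u v w (p : Adj u v) (q : Adj u w) → v ≢ w → col c u v p ≢ col c u w q

    InclusionFree : Set
    InclusionFree = Proper ×
      (∀ u v → Adj u v → ¬ PaletteSubset u v × ¬ PaletteSubset v u)

  InclusionChromaticIndex≤ : ℕ → Set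
  InclusionChromaticIndex≤ k = Σ (EdgeColouring k) InclusionFree

{-# OPTIONS --safe #-}

-- Order the vertices by degree, breaking ties arbitrarily, and add them one by
-- one from the largest to the smallest, colouring at each step the edges from
-- the new vertex y to its larger neighbours x₁, …, xₖ.  For an edge uv with
-- u below v it is enough that S(u) ⊈ S(v), because |S(u)| ≤ |S(v)|; and once
-- this holds, new colours at u can only help.  The invariant is that it holds
-- for every coloured edge uv, u below v, such that u has two coloured edges.
-- The colour of yxᵢ avoids S(xᵢ), one element of S(w) ∖ S(xᵢ) for every other
-- neighbour w of xᵢ, and S(xᵢ₊₁) with cyclic indices (or only S(y), if already
-- S(y) ⊈ S(xᵢ₊₁)): at most (Δ − 1) + (Δ − 1) + Δ colours.  If xᵢ has a single
-- coloured edge xᵢz, then S(z) is avoided in place of the first two sets.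
module Submission where

open import Defs
open import Data.Bool using (Bool; T; T?; if_then_else_; true; false)
open import Data.Fin using (Fin; toℕ; _≟_)
open import Data.Fin.Properties using (any?; toℕ-injective; toℕ<n)
open import Data.Fin.Subset using (∣_∣)
open import Data.List using (List; []; _∷_; _++_; length; filter; mapMaybe; allFin; tabulate)
import Data.List.Membership.DecPropositional as DecMembership
open import Data.List.Membership.Propositional using (_∈_; _∉_)
open import Data.List.Membership.Propositional.Properties using (∈-∃++; ∈-++⁻; ∈-++⁺ˡ; ∈-++⁺ʳ; ∈-filter⁺; ∈-filter⁻; ∈-allFin; ∈-map⁺)
open import Data.List.Properties using (length-++; length-mapMaybe; length-tabulate; filter-notAll)
open import Data.List.Relation.Unary.All using (_∷_) renaming (lookup to All-lookup)
open import Data.List.Relation.Unary.AllPairs using (_∷_)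
open import Data.List.Relation.Unary.Any using (here; there) renaming (map to Any-map)
open import Data.List.Relation.Unary.Any.Properties using (mapMaybe⁺)
import Data.List.Relation.Unary.Unique.Propositional.Properties as Unique
open import Data.List.Relation.Unary.Unique.Propositional using (Unique)
open import Data.Maybe using (Maybe; just; nothing)
open import Data.Maybe.Properties using (≡-dec; just-injective)
import Data.Maybe.Relation.Unary.Any as Maybe
open import Data.Nat using (ℕ; zero; suc; _+_; _*_; _∸_; _≤_; _<_; z≤n; s≤s; _<?_)
import Data.Nat as ℕ
open import Data.Nat.Properties using (<-cmp; ≤-refl; ≤-reflexive; ≤-trans; ≤-<-trans; <-irrefl; <-asym; <⇒≤; <⇒≱; ≮⇒≥; ≤-pred; ≤∧≢⇒<; m≤m+n; +-mono-≤; +-monoʳ-<; +-comm; +-suc; +-cancelˡ-≡; *-monoˡ-≤; module ≤-Reasoning)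
open import Data.Nat.Solver using (module +-*-Solver)
open import Data.Product using (Σ; ∃-syntax; ∃₂; _×_; _,_; proj₁; proj₂)
open import Data.Sum using (_⊎_; inj₁; inj₂; [_,_]′)
import Data.Vec as Vec
open import Function using (_∘_; id)
open import Relation.Binary.Definitions using (tri<; tri≈; tri>)
open import Relation.Binary.PropositionalEquality using (_≡_; _≢_; refl; trans; cong; subst) renaming (sym to ≡-sym)
open import Relation.Nullary using (¬_; Dec; yes; no; does; contradiction)
open import Relation.Nullary.Decidable using (_×-dec_; _⊎-dec_; ¬?; decidable-stable; dec-true; dec-false)

module _ {A B : Set} (R : A → B → Set) (R-injective : ∀ {x x′ y} → R x y → R x′ y → x ≡ x′) where

  -- Induction on `xs`, deleting from `ys` the partner of the head; injectivity and uniqueness keep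
  -- it from serving a later entry. A relation is used because the colour of an edge is only known
  -- through an equation `at P v w ≡ just a`.
  pigeonhole-length : ∀ {xs ys} → Unique xs → (∀ {x} → x ∈ xs → ∃[ y ] y ∈ ys × R x y) →
    length xs ≤ length ys
  pigeonhole-length {[]} _ _ = z≤n
  pigeonhole-length {x ∷ xs} (x∉xs ∷ uniq) f with f (here refl)
  ... | y , y∈ys , Rxy with ∈-∃++ y∈ys
  ... | as , bs , refl = begin
    suc (length xs)              ≤⟨ s≤s (pigeonhole-length uniq f′) ⟩
    suc (length (as ++ bs))      ≡⟨ cong suc (length-++ as) ⟩
    suc (length as + length bs)  ≡⟨ +-suc (length as) (length bs) ⟨
    length as + suc (length bs)  ≡⟨ length-++ as ⟨
    length (as ++ y ∷ bs)        ∎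
    where
    open ≤-Reasoning
    f′ : ∀ {x′} → x′ ∈ xs → ∃[ y′ ] y′ ∈ as ++ bs × R x′ y′
    f′ x′∈xs with f (there x′∈xs)
    ... | y′ , y′∈ys , Rx′y′ with ∈-++⁻ as y′∈ys
    ... | inj₁ y′∈as = y′ , ∈-++⁺ˡ y′∈as , Rx′y′
    ... | inj₂ (there y′∈bs) = y′ , ∈-++⁺ʳ as y′∈bs , Rx′y′
    ... | inj₂ (here refl) = contradiction (R-injective Rxy Rx′y′) (All-lookup x∉xs x′∈xs)

fresh : ∀ {k} (cs : List (Fin k)) → length cs < k → ∃[ c ] c ∉ cs
fresh {k} cs cs<k with any? (λ c → ¬? (DecMembership._∈?_ _≟_ c cs))
... | yes found = found
... | no ¬found = contradiction k≤cs (<⇒≱ cs<k)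
  where
  everywhere : ∀ c → c ∈ cs
  everywhere c = decidable-stable (DecMembership._∈?_ _≟_ c cs) (λ c∉cs → ¬found (c , c∉cs))
  k≤cs : k ≤ length cs
  k≤cs = subst (_≤ length cs) (length-tabulate {n = k} id)
    (pigeonhole-length _≡_ (λ p q → trans p (≡-sym q)) (Unique.allFin⁺ k) (λ {c} _ → c , everywhere c , refl))

∈-mapMaybe⁺ : ∀ {A B : Set} (f : A → Maybe B) {x y xs} → x ∈ xs → f x ≡ just y → y ∈ mapMaybe f xs
∈-mapMaybe⁺ f {y = y} {xs} x∈xs fx≡y =
  mapMaybe⁺ f xs (Any-map (λ fx≡m → subst (Maybe.Any (y ≡_)) (trans (≡-sym fx≡y) fx≡m) (Maybe.just refl)) (∈-map⁺ f x∈xs))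

length-filter-tabulate : ∀ {A : Set} m (f : A → Bool) (g : Fin m → A) →
  length (filter (T? ∘ f) (tabulate g)) ≡ ∣ Vec.tabulate (f ∘ g) ∣
length-filter-tabulate zero f g = refl
length-filter-tabulate (suc m) f g with f (g Fin.zero)
... | true  = cong suc (length-filter-tabulate m f (g ∘ Fin.suc))
... | false = length-filter-tabulate m f (g ∘ Fin.suc)

-- Neighbourhoods as duplicate-free lists.

module _ (G : Graph) where

  private V = Fin (n G)

  Adj-sym : ∀ {u v} → Adj G u v → Adj G v u
  Adj-sym {u} {v} = subst T (sym G u v)

  Adj-irrefl : ∀ {v} → ¬ Adj G v v
  Adj-irrefl {v} = subst T (irrefl G v)

  neighbours : V → List V
  neighbours v = filter (T? ∘ adj G v) (allFin (n G))

  ∈-neighbours⁺ : ∀ {u v} → Adj G u v → v ∈ neighbours u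
  ∈-neighbours⁺ {u} {v} = ∈-filter⁺ (T? ∘ adj G u) (∈-allFin v)

  ∈-neighbours⁻ : ∀ {u v} → v ∈ neighbours u → Adj G u v
  ∈-neighbours⁻ {u} v∈ = proj₂ (∈-filter⁻ (T? ∘ adj G u) {xs = allFin (n G)} v∈)

  neighbours-unique : ∀ v → Unique (neighbours v)
  neighbours-unique v = Unique.filter⁺ (T? ∘ adj G v) (Unique.allFin⁺ (n G))

  length-neighbours : ∀ v → length (neighbours v) ≡ deg G v
  length-neighbours v = length-filter-tabulate (n G) (adj G v) id

  otherNeighbours : V → V → List V
  otherNeighbours v u = filter (λ w → ¬? (w ≟ u)) (neighbours v)

  ∈-otherNeighbours⁺ : ∀ {v u w} → Adj G v w → w ≢ u → w ∈ otherNeighbours v u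
  ∈-otherNeighbours⁺ {u = u} p = ∈-filter⁺ (λ w → ¬? (w ≟ u)) (∈-neighbours⁺ p)

  -- Strictness comes from the deletion of `u` itself; it is the source of both terms Δ - 1 in the
  -- colour count.
  length-otherNeighbours : ∀ {v u} → Adj G v u → length (otherNeighbours v u) < deg G v
  length-otherNeighbours {v} {u} p = subst (length (otherNeighbours v u) <_) (length-neighbours v)
    (filter-notAll (λ w → ¬? (w ≟ u)) (neighbours v)
      (Any-map (λ { refl w≢u → w≢u refl }) (∈-neighbours⁺ p)))

  -- Partial proper colourings and their palettes.

  record Partial (k : ℕ) : Set where
    field
      at        : V → V → Maybe (Fin k)
      at-sym    : ∀ u v → at u v ≡ at v u
      at-adj    : ∀ {u v a} → at u v ≡ just a → Adj G u v
      -- Contrapositive form: a colour at `u` determines the edge, which is the injectivity that the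
      -- pigeonhole lemma takes.
      at-proper : ∀ {u v w a} → at u v ≡ just a → at u w ≡ just a → v ≡ w
  open Partial

  empty : ∀ {k} → Partial k
  empty = record
    { at = λ _ _ → nothing ; at-sym = λ _ _ → refl ; at-adj = λ () ; at-proper = λ () }

  module _ {k : ℕ} (P : Partial k) where

    Coloured : V → V → Set
    Coloured u v = ∃[ a ] at P u v ≡ just a

    Palette : V → Fin k → Set
    Palette v a = ∃[ u ] at P v u ≡ just a

    -- Non-inclusion of palettes in positive form: an explicit colour can be protected in later
    -- steps.
    Escapes : V → V → Set
    Escapes u v = ∃[ a ] Palette u a × ¬ Palette v a

    -- The invariant has to wait for a second edge: if uv is the only coloured edge at `u`, then
    -- S(u) consists of its colour and lies in S(v).
    Branching : V → Set
    Branching u = ∃₂ λ v w → v ≢ w × Coloured u v × Coloured u w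

    coloured? : ∀ u v → Dec (Coloured u v)
    coloured? u v = any? (λ a → ≡-dec _≟_ (at P u v) (just a))

    palette? : ∀ v a → Dec (Palette v a)
    palette? v a = any? (λ u → ≡-dec _≟_ (at P v u) (just a))

    escapes? : ∀ u v → Dec (Escapes u v)
    escapes? u v = any? (λ a → palette? u a ×-dec ¬? (palette? v a))

    branching? : ∀ u → Dec (Branching u)
    branching? u = any? (λ v → any? (λ w → ¬? (v ≟ w) ×-dec (coloured? u v ×-dec coloured? u w)))

    coloured-sym : ∀ {u v} → Coloured u v → Coloured v u
    coloured-sym {u} {v} (a , e) = a , trans (at-sym P v u) e

    colours : V → List (Fin k)
    colours v = mapMaybe (at P v) (neighbours v)

    ∈-colours⁺ : ∀ {v a} → Palette v a → a ∈ colours v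
    ∈-colours⁺ {v} (u , e) = ∈-mapMaybe⁺ (at P v) (∈-neighbours⁺ (at-adj P e)) e

    length-colours : ∀ v → length (colours v) ≤ deg G v
    length-colours v = ≤-trans (length-mapMaybe (at P v) (neighbours v)) (≤-reflexive (length-neighbours v))

    otherColours : V → V → List (Fin k)
    otherColours v u = mapMaybe (at P v) (otherNeighbours v u)

    -- Fixing one colour of S(w) outside S(v) makes the protection of this escape cost a single
    -- forbidden colour.
    witness : V → V → Maybe (Fin k)
    witness v w with escapes? w v
    ... | yes (a , _) = just a
    ... | no _        = nothing

    witness-escapes : ∀ {v w} → Escapes w v → ∃[ a ] witness v w ≡ just a × Palette w a × ¬ Palette v a
    witness-escapes {v} {w} esc with escapes? w v
    ... | yes (a , p) = a , refl , p
    ... | no ¬esc     = contradiction esc ¬esc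

    witnesses : V → V → List (Fin k)
    witnesses v u = mapMaybe (witness v) (otherNeighbours v u)

  -- Colouring one further edge.

  module Insertion {k : ℕ} (P : Partial k) {y x : V} (yx : Adj G y x) (¬col : ¬ Coloured P y x)
                   {c : Fin k} (c∉y : ¬ Palette P y c) (c∉x : ¬ Palette P x c) where

    private
      y≢x : y ≢ x
      y≢x refl = Adj-irrefl yx

    New : V → V → Set
    New u v = (u ≡ y × v ≡ x) ⊎ (u ≡ x × v ≡ y)

    new? : ∀ u v → Dec (New u v)
    new? u v = (u ≟ y ×-dec v ≟ x) ⊎-dec (u ≟ x ×-dec v ≟ y)

    New-sym : ∀ {u v} → New u v → New v u
    New-sym (inj₁ (p , q)) = inj₂ (q , p)
    New-sym (inj₂ (p , q)) = inj₁ (q , p)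

    private
      -- Opaque, so that with-abstraction over vertex comparisons leaves it alone.
      abstract
        at′ : V → V → Maybe (Fin k)
        at′ u v = if does (new? u v) then just c else at P u v

        at′-new : ∀ {u v} → New u v → at′ u v ≡ just c
        at′-new {u} {v} new rewrite dec-true (new? u v) new = refl

        at′-¬new : ∀ {u v} → ¬ New u v → at′ u v ≡ at P u v
        at′-¬new {u} {v} ¬new rewrite dec-false (new? u v) ¬new = refl

      at′-inv : ∀ {u v a} → at′ u v ≡ just a → at P u v ≡ just a ⊎ (New u v × a ≡ c)
      at′-inv {u} {v} e with new? u v
      ... | yes new = inj₂ (new , just-injective (trans (≡-sym e) (at′-new new)))
      ... | no ¬new = inj₁ (trans (≡-sym (at′-¬new ¬new)) e)

      at′-sym : ∀ u v → at′ u v ≡ at′ v u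
      at′-sym u v with new? u v
      ... | yes new = trans (at′-new new) (≡-sym (at′-new (New-sym new)))
      ... | no ¬new = trans (at′-¬new ¬new) (trans (at-sym P u v) (≡-sym (at′-¬new (¬new ∘ New-sym))))

      New⇒Adj : ∀ {u v} → New u v → Adj G u v
      New⇒Adj (inj₁ (refl , refl)) = yx
      New⇒Adj (inj₂ (refl , refl)) = Adj-sym yx

      New-fresh : ∀ {u v} → New u v → ¬ Palette P u c
      New-fresh (inj₁ (refl , _)) = c∉y
      New-fresh (inj₂ (refl , _)) = c∉x

      New-functional : ∀ {u v w} → New u v → New u w → v ≡ w
      New-functional (inj₁ (_ , refl)) (inj₁ (_ , refl)) = refl
      New-functional (inj₂ (_ , refl)) (inj₂ (_ , refl)) = refl
      New-functional (inj₁ (refl , _)) (inj₂ (e , _)) = contradiction e y≢x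
      New-functional (inj₂ (refl , _)) (inj₁ (e , _)) = contradiction (≡-sym e) y≢x

      at′-proper : ∀ {u v w a} → at′ u v ≡ just a → at′ u w ≡ just a → v ≡ w
      at′-proper e f with at′-inv e | at′-inv f
      ... | inj₁ e′           | inj₁ f′           = at-proper P e′ f′
      ... | inj₁ e′           | inj₂ (new , refl) = contradiction (_ , e′) (New-fresh new)
      ... | inj₂ (new , refl) | inj₁ f′           = contradiction (_ , f′) (New-fresh new)
      ... | inj₂ (new , _)    | inj₂ (new′ , _)   = New-functional new new′

    insert : Partial k
    insert = record
      { at = at′
      ; at-sym = at′-sym
      ; at-adj = λ e → [ at-adj P , New⇒Adj ∘ proj₁ ]′ (at′-inv e)
      ; at-proper = at′-proper
      }

    insert-old : ∀ {u v a} → at P u v ≡ just a → at insert u v ≡ just a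
    insert-old {u} {v} {a} e = trans (at′-¬new ¬new) e
      where
      ¬new : ¬ New u v
      ¬new (inj₁ (refl , refl)) = ¬col (a , e)
      ¬new (inj₂ (refl , refl)) = ¬col (coloured-sym P (a , e))

    coloured-old : ∀ {u v} → Coloured P u v → Coloured insert u v
    coloured-old (a , e) = a , insert-old e

    coloured-new : ∀ {u v} → New u v → Coloured insert u v
    coloured-new new = c , at′-new new

    coloured-inv : ∀ {u v} → Coloured insert u v → Coloured P u v ⊎ New u v
    coloured-inv (a , e) = [ (λ e′ → inj₁ (a , e′)) , inj₂ ∘ proj₁ ]′ (at′-inv e)

    palette-old : ∀ {v a} → Palette P v a → Palette insert v a
    palette-old (u , e) = u , insert-old e

    palette-inv : ∀ {v a} → Palette insert v a → Palette P v a ⊎ a ≡ c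
    palette-inv (u , e) = [ (λ e′ → inj₁ (u , e′)) , inj₂ ∘ proj₂ ]′ (at′-inv e)

    private
      ¬New-away : ∀ {u v} → u ≢ y → u ≢ x → ¬ New u v
      ¬New-away u≢y u≢x (inj₁ (e , _)) = u≢y e
      ¬New-away u≢y u≢x (inj₂ (e , _)) = u≢x e

    coloured-away : ∀ {u v} → u ≢ y → u ≢ x → Coloured insert u v → Coloured P u v
    coloured-away u≢y u≢x p = [ id , (λ new → contradiction new (¬New-away u≢y u≢x)) ]′ (coloured-inv p)

    branching-away : ∀ {u} → u ≢ y → u ≢ x → Branching insert u → Branching P u
    branching-away u≢y u≢x (v , w , v≢w , p , q) =
      v , w , v≢w , coloured-away u≢y u≢x p , coloured-away u≢y u≢x q

    palette-away : ∀ {v a} → v ≢ y → v ≢ x → Palette insert v a → Palette P v a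
    palette-away v≢y v≢x (u , e) =
      [ (λ e′ → u , e′) , (λ new → contradiction (proj₁ new) (¬New-away v≢y v≢x)) ]′ (at′-inv e)

    -- S(u) can only grow, and S(v) is unchanged because `v` is not an end of the new edge.
    escapes-away : ∀ {u v} → v ≢ y → v ≢ x → Escapes P u v → Escapes insert u v
    escapes-away v≢y v≢x (a , a∈u , a∉v) = a , palette-old a∈u , a∉v ∘ palette-away v≢y v≢x

    escapes-avoiding : ∀ {u v a} → Palette P u a → ¬ Palette P v a → a ≢ c → Escapes insert u v
    escapes-avoiding a∈u a∉v a≢c = _ , palette-old a∈u , [ a∉v , a≢c ]′ ∘ palette-inv

    -- A witness taken from S(y) differs from `c`, which was absent there, so it stays valid even
    -- when `v` is `x` and gains `c`.
    escapes-y : ∀ {v} → v ≢ y → Escapes P y v → Escapes insert y v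
    escapes-y {v} v≢y esc@(a , a∈y , a∉v) with v ≟ x
    ... | yes refl = escapes-avoiding a∈y a∉v (λ { refl → c∉y a∈y })
    ... | no v≢x   = escapes-away v≢y v≢x esc

    palette-new-y : Palette insert y c
    palette-new-y = x , at′-new (inj₁ (refl , refl))

    palette-new-x : Palette insert x c
    palette-new-x = y , at′-new (inj₂ (refl , refl))

  -- Choosing the colour of one edge, with `Δ₁` standing for Δ - 1.

  module Greedy (Δ₁ k : ℕ) (1≤Δ₁ : 1 ≤ Δ₁) (deg≤ : ∀ v → deg G v ≤ suc Δ₁)
                (enough : Δ₁ + Δ₁ + suc Δ₁ < k)
                (key : V → ℕ) (key-injective : ∀ {u v} → key u ≡ key v → u ≡ v) where

    -- The demands of the endpoint `x` on the colour of a new edge: properness, survival of the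
    -- escapes from S(x) that neighbours already have, and, if `x` is not yet branching, an escape
    -- of its own for the moment it becomes so.
    record Safe (P : Partial k) (x : V) (c : Fin k) : Set where
      field
        unused   : ¬ Palette P x c
        incoming : ∀ {w} → Coloured P x w → Escapes P w x → ∃[ a ] Palette P w a × ¬ Palette P x a × a ≢ c
        outgoing : ∀ {v} → ¬ Branching P x → Coloured P x v → ¬ Palette P v c
    open Safe

    -- A branching `x` pays twice for its at most `Δ₁` other edges, once for colours and once for
    -- witnesses. With a single coloured edge xz, avoiding S(z) meets all three demands: S(z)
    -- contains the colour of xz and every witness for `z`, and `c` becomes a witness for `x`.
    guard : ∀ (P : Partial k) {x y} → Adj G x y → ¬ Coloured P x y →
      ∃[ cs ] length cs ≤ Δ₁ + Δ₁ × (∀ {c} → c ∉ cs → Safe P x c)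
    guard P {x} {y} xy ¬col with branching? P x
    ... | yes br = otherColours P x y ++ witnesses P x y , bound , λ c∉ → record
      { unused = λ (u , e) → c∉ (∈-++⁺ˡ
          (∈-mapMaybe⁺ (at P x) (∈-otherNeighbours⁺ (at-adj P e) (λ { refl → ¬col (_ , e) })) e))
      ; incoming = λ { {w} (_ , e) esc → let (a , eq , a∈w , a∉x) = witness-escapes P esc in
          a , a∈w , a∉x , λ { refl → c∉ (∈-++⁺ʳ (otherColours P x y)
            (∈-mapMaybe⁺ (witness P x) (∈-otherNeighbours⁺ (at-adj P e) (λ { refl → ¬col (_ , e) })) eq)) } }
      ; outgoing = λ ¬br → contradiction br ¬br
      }
      where
      others≤ : length (otherNeighbours x y) ≤ Δ₁
      others≤ = ≤-pred (≤-trans (length-otherNeighbours xy) (deg≤ x))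
      bound : length (otherColours P x y ++ witnesses P x y) ≤ Δ₁ + Δ₁
      bound = subst (_≤ Δ₁ + Δ₁) (≡-sym (length-++ (otherColours P x y))) (+-mono-≤
        (≤-trans (length-mapMaybe (at P x) (otherNeighbours x y)) others≤)
        (≤-trans (length-mapMaybe (witness P x) (otherNeighbours x y)) others≤))
    ... | no ¬br with any? (coloured? P x)
    ... | no none = [] , z≤n , λ _ → record
      { unused = λ (u , e) → none (u , _ , e)
      ; incoming = λ p → contradiction (_ , p) none
      ; outgoing = λ _ p → contradiction (_ , p) none
      }
    ... | yes (z , xz@(b , xz≡b)) = colours P z
      -- S(z) may have `Δ₁ + 1` colours, which is within `Δ₁ + Δ₁` because `Δ₁` is at least 1.
      , ≤-trans (length-colours P z) (≤-trans (deg≤ z) (+-mono-≤ 1≤Δ₁ ≤-refl))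
      , λ {c} c∉ → record
      { unused = λ (u , e) → c∉ (∈-colours⁺ P
          (x , trans (at-sym P z x) (subst (λ w → at P x w ≡ just c) (only (_ , e)) e)))
      ; incoming = λ p (a , a∈w , a∉x) → a , a∈w , a∉x ,
          λ { refl → c∉ (∈-colours⁺ P (subst (λ w → Palette P w a) (only p) a∈w)) }
      ; outgoing = λ _ p c∈v → c∉ (∈-colours⁺ P (subst (λ w → Palette P w c) (only p) c∈v))
      }
      where
      only : ∀ {w} → Coloured P x w → w ≡ z
      only {w} p with w ≟ z
      ... | yes w≡z = w≡z
      ... | no w≢z  = contradiction (w , z , w≢z , p , xz) ¬br

    -- One palette always suffices: when `y` does not yet escape `t`, S(y) lies in S(t), so avoiding
    -- S(t) also secures properness at `y`.
    target : ∀ (P : Partial k) y t → ∃[ cs ] length cs ≤ suc Δ₁ ×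
      (∀ {c} → c ∉ cs → ¬ Palette P y c × (Escapes P y t ⊎ ¬ Palette P t c))
    target P y t with escapes? P y t
    ... | yes esc = colours P y , ≤-trans (length-colours P y) (deg≤ y) ,
      λ c∉ → c∉ ∘ ∈-colours⁺ P , inj₁ esc
    ... | no ¬esc = colours P t , ≤-trans (length-colours P t) (deg≤ t) ,
      λ c∉ → c∉ ∘ ∈-colours⁺ P ∘ y⊆t , inj₂ (c∉ ∘ ∈-colours⁺ P)
      where
      y⊆t : ∀ {a} → Palette P y a → Palette P t a
      y⊆t {a} a∈y = decidable-stable (palette? P t a) (λ a∉t → ¬esc (a , a∈y , a∉t))

    -- The invariant is stated vertex by vertex so that it can be suspended at the vertex being
    -- added.
    FreeAt : Partial k → V → Set
    FreeAt P u = ∀ {v} → Coloured P u v → key u < key v → Branching P u → Escapes P u v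

    -- Hides the chosen colour and exposes its effects. The target `t` is normally the neighbour of
    -- `y` whose edge comes next.
    record Extension (P : Partial k) (y x t : V) : Set where
      field
        result   : Partial k
        old      : ∀ {u v} → Coloured P u v → Coloured result u v
        new      : Coloured result y x
        inv      : ∀ {u v} → Coloured result u v → Coloured P u v ⊎ ((u ≡ y × v ≡ x) ⊎ (u ≡ x × v ≡ y))
        others   : ∀ {u} → u ≢ y → FreeAt result u
        keeps    : ∀ {v} → v ≢ y → Escapes P y v → Escapes result y v
        achieves : t ≢ y → t ≢ x → Escapes result y t

    -- As `y` has no lower coloured neighbour, the invariant never requires an escape from S(y), so
    -- this palette may grow freely. Only edges meeting `x` need care, and `Safe` handles them.
    extend : ∀ (P : Partial k) {y x} t → Adj G y x → ¬ Coloured P y x → key y < key x →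
      (∀ {u} → Coloured P u y → ¬ key u < key y) → (∀ {u} → u ≢ y → FreeAt P u) → Extension P y x t
    extend P {y} {x} t yx ¬col y<x lowest free
      with guard P (Adj-sym yx) (¬col ∘ coloured-sym P) | target P y t
    ... | cs , cs≤ , safe | ds , ds≤ , aims
      with fresh (cs ++ ds) (≤-<-trans (subst (_≤ _) (≡-sym (length-++ cs)) (+-mono-≤ cs≤ ds≤)) enough)
    ... | c , c∉ = record
      { result = insert
      ; old = coloured-old
      ; new = coloured-new (inj₁ (refl , refl))
      ; inv = coloured-inv
      ; others = others
      ; keeps = escapes-y
      ; achieves = achieves
      }
      where
      s : Safe P x c
      s = safe (c∉ ∘ ∈-++⁺ˡ)
      c∉y : ¬ Palette P y c
      c∉y = proj₁ (aims (c∉ ∘ ∈-++⁺ʳ cs))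
      c∉x : ¬ Palette P x c
      c∉x = unused s
      open Insertion P yx ¬col c∉y c∉x

      others : ∀ {u} → u ≢ y → FreeAt insert u
      others {u} u≢y {v} uv u<v br with coloured-inv uv
      ... | inj₂ (inj₁ (u≡y , _)) = contradiction u≡y u≢y
      ... | inj₂ (inj₂ (refl , refl)) = contradiction u<v (<-asym y<x)
      ... | inj₁ uv′ with v ≟ y
      ... | yes refl = contradiction u<v (lowest uv′)
      ... | no v≢y with u ≟ x
      ... | no u≢x with free u≢y uv′ u<v (branching-away u≢y u≢x br) | v ≟ x
      ... | esc | no v≢x = escapes-away v≢y v≢x esc
      -- Here S(v) gains `c`, so a witness different from `c` is required.
      ... | esc | yes refl with incoming s (coloured-sym P uv′) esc
      ... | a , a∈u , a∉x , a≢c = escapes-avoiding a∈u a∉x a≢c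
      others {u} u≢y {v} uv u<v br | inj₁ uv′ | no v≢y | yes refl with branching? P x
      ... | yes br′ = escapes-away v≢y v≢x (free u≢y uv′ u<v br′)
        where
        v≢x : v ≢ x
        v≢x refl = <-irrefl refl u<v
      -- The new edge is what makes `x` branching, and its colour is the witness.
      ... | no ¬br = c , palette-new-x ,
          outgoing s ¬br uv′ ∘ palette-away v≢y v≢x
        where
        v≢x : v ≢ x
        v≢x refl = <-irrefl refl u<v

      achieves : t ≢ y → t ≢ x → Escapes insert y t
      achieves t≢y t≢x with proj₂ (aims (c∉ ∘ ∈-++⁺ʳ cs))
      ... | inj₁ esc = escapes-away t≢y t≢x esc
      ... | inj₂ c∉t = c , palette-new-y , c∉t ∘ palette-away t≢y t≢x

    -- Adding the vertices in decreasing order.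

    record Stage (m : ℕ) : Set where
      field
        partial  : Partial k
        complete : ∀ {u v} → Adj G u v → m ≤ key u → m ≤ key v → Coloured partial u v
        bounded  : ∀ {u v} → Coloured partial u v → m ≤ key u
        free     : ∀ {u} → FreeAt partial u

    module _ (y : V) where

      -- The state midway through the edges from `y` to its higher neighbours: `xs` lists those
      -- still uncoloured, and the invariant is waived at `y`.
      record Pending (P : Partial k) (xs : List V) : Set where
        field
          complete : ∀ {u v} → Adj G u v → key y < key u → key y < key v → Coloured P u v
          bounded  : ∀ {u v} → Coloured P u v → key y ≤ key u
          unique   : Unique xs
          todo     : ∀ {x} → x ∈ xs → Adj G y x × key y < key x × ¬ Coloured P y x
          done     : ∀ {x} → Adj G y x → key y < key x → x ∈ xs ⊎ Coloured P y x
          others   : ∀ {u} → u ≢ y → FreeAt P u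

      finish : ∀ {P} → Pending P [] → FreeAt P y → Stage (key y)
      finish {P} pend free-y = record
        { partial = P ; complete = complete′ ; bounded = bounded ; free = free′ }
        where
        open Pending pend
        from-y : ∀ {v} → Adj G y v → key y ≤ key v → Coloured P y v
        from-y {v} yv y≤v with done yv (≤∧≢⇒< y≤v (λ e → Adj-irrefl (subst (Adj G y) (≡-sym (key-injective e)) yv)))
        ... | inj₂ p = p
        complete′ : ∀ {u v} → Adj G u v → key y ≤ key u → key y ≤ key v → Coloured P u v
        complete′ {u} {v} uv y≤u y≤v with u ≟ y | v ≟ y
        ... | yes refl | _        = from-y uv y≤v
        ... | no _     | yes refl = coloured-sym P (from-y (Adj-sym uv) y≤u)
        ... | no u≢y   | no v≢y   = complete uv
          (≤∧≢⇒< y≤u (u≢y ∘ ≡-sym ∘ key-injective)) (≤∧≢⇒< y≤v (v≢y ∘ ≡-sym ∘ key-injective))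
        free′ : ∀ {u} → FreeAt P u
        free′ {u} with u ≟ y
        ... | yes refl = free-y
        ... | no u≢y   = others u≢y

      todo-≢ : ∀ {P xs x} → Pending P xs → x ∈ xs → x ≢ y
      todo-≢ pend x∈ refl = Adj-irrefl (proj₁ (Pending.todo pend x∈))

      advance : ∀ {P x xs} → Pending P (x ∷ xs) → ∀ t →
        Σ (Extension P y x t) λ E → Pending (Extension.result E) xs
      advance {P} {x} {xs} pend t = E , record
        { complete = λ uv y<u y<v → old (complete uv y<u y<v)
        ; bounded = bounded′
        ; unique = uniq-tail unique
        ; todo = todo′
        ; done = done′
        ; others = E-others
        }
        where
        open Pending pend
        yx = proj₁ (todo (here refl))
        y<x = proj₁ (proj₂ (todo (here refl)))
        E : Extension P y x t
        E = extend P t yx (proj₂ (proj₂ (todo (here refl)))) y<x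
          (λ uy u<y → <⇒≱ u<y (bounded uy)) others
        open Extension E renaming (others to E-others)
        uniq-tail : Unique (x ∷ xs) → Unique xs
        uniq-tail (_ ∷ u) = u
        bounded′ : ∀ {u v} → Coloured result u v → key y ≤ key u
        bounded′ p with inv p
        ... | inj₁ q                 = bounded q
        ... | inj₂ (inj₁ (refl , _)) = ≤-refl
        ... | inj₂ (inj₂ (refl , _)) = <⇒≤ y<x
        head-∉ : Unique (x ∷ xs) → x ∉ xs
        head-∉ (x∉ ∷ _) x∈ = All-lookup x∉ x∈ refl
        todo′ : ∀ {z} → z ∈ xs → Adj G y z × key y < key z × ¬ Coloured result y z
        todo′ {z} z∈ with todo (there z∈)
        ... | yz , y<z , ¬col = yz , y<z , ¬col′
          where
          ¬col′ : ¬ Coloured result y z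
          ¬col′ p with inv p
          ... | inj₁ q                 = ¬col q
          ... | inj₂ (inj₁ (_ , refl)) = head-∉ unique z∈
          ... | inj₂ (inj₂ (_ , refl)) = Adj-irrefl yz
        done′ : ∀ {z} → Adj G y z → key y < key z → z ∈ xs ⊎ Coloured result y z
        done′ yz y<z with done yz y<z
        ... | inj₁ (here refl) = inj₂ new
        ... | inj₁ (there z∈)  = inj₁ z∈
        ... | inj₂ p           = inj₂ (old p)

      coloured-at-y : ∀ {P x t} (E : Extension P y x t) {v} → Coloured (Extension.result E) y v →
        Coloured P y v ⊎ v ≡ x
      coloured-at-y E p with Extension.inv E p
      ... | inj₁ q                    = inj₁ q
      ... | inj₂ (inj₁ (_ , v≡x))     = inj₂ v≡x
      ... | inj₂ (inj₂ (y≡x , v≡y))   = inj₂ (trans v≡y y≡x)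

      -- f is the first neighbour treated: it becomes the target when the list runs out.
      loop : ∀ {P} f x xs → f ≢ y → f ∉ x ∷ xs → Pending P (x ∷ xs) → Escapes P y x →
        (∀ {v} → Coloured P y v → v ≢ f → Escapes P y v) → Stage (key y)
      loop {P} f x [] f≢y f∉ pend esc own with advance pend f
      ... | E , pend′ = finish pend′ λ p _ _ → free-y p
        where
        open Extension E
        free-y : ∀ {v} → Coloured result y v → Escapes result y v
        free-y {v} p with v ≟ f | coloured-at-y E p
        ... | yes refl | _         = achieves f≢y (f∉ ∘ here)
        ... | no v≢f   | inj₂ refl = keeps (todo-≢ pend (here refl)) esc
        ... | no v≢f   | inj₁ q    = keeps (λ { refl → Adj-irrefl (at-adj P (proj₂ q)) }) (own q v≢f)
      loop {P} f x (z ∷ zs) f≢y f∉ pend esc own with advance pend z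
      -- The escape from S(x) was secured one step earlier and survives the colouring of yx, whose
      -- colour in turn secures the escape from S(z).
      ... | E , pend′ = loop f z zs f≢y (f∉ ∘ there) pend′
          (achieves (todo-≢ pend (there (here refl))) z≢x) own′
        where
        open Extension E
        z≢x : z ≢ x
        z≢x with Pending.unique pend
        ... | x∉ ∷ _ = All-lookup x∉ (here refl) ∘ ≡-sym
        own′ : ∀ {v} → Coloured result y v → v ≢ f → Escapes result y v
        own′ p v≢f with coloured-at-y E p
        ... | inj₂ refl = keeps (todo-≢ pend (here refl)) esc
        ... | inj₁ q    = keeps (λ { refl → Adj-irrefl (at-adj P (proj₂ q)) }) (own q v≢f)

      addEdges : ∀ {P} xs → Pending P xs → (∀ {v} → ¬ Coloured P y v) → Stage (key y)
      addEdges [] pend ¬col = finish pend (λ p → contradiction p ¬col)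
      -- With one edge `y` is not branching and owes no escape; the target `y` is a dummy, for which
      -- `achieves` is vacuous.
      addEdges (f ∷ []) pend ¬col with advance pend y
      ... | E , pend′ = finish pend′ λ _ _ (v , w , v≢w , p , q) → contradiction (trans (only p) (≡-sym (only q))) v≢w
        where
        only : ∀ {v} → Coloured (Extension.result E) y v → v ≡ f
        only p = [ (λ q → contradiction q ¬col) , id ]′ (coloured-at-y E p)
      -- The first edge already aims at `z`, so `loop` starts with that escape in hand and only the
      -- one from S(f) outstanding.
      addEdges (f ∷ z ∷ zs) pend ¬col with advance pend z
      ... | E , pend′ = loop f z zs (todo-≢ pend (here refl)) (f∉ (Pending.unique pend)) pend′
          (Extension.achieves E (todo-≢ pend (there (here refl))) (λ { refl → f∉ (Pending.unique pend) (here refl) }))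
          (λ p v≢f → contradiction ([ (λ q → contradiction q ¬col) , id ]′ (coloured-at-y E p)) v≢f)
        where
        f∉ : Unique (f ∷ z ∷ zs) → f ∉ z ∷ zs
        f∉ (f∉′ ∷ _) f∈ = All-lookup f∉′ f∈ refl

      addVertex : Stage (suc (key y)) → Stage (key y)
      addVertex st = addEdges (filter above? (neighbours y)) pend (λ p → <-irrefl refl (bounded p))
        where
        open Stage st
        above? : ∀ x → Dec (key y < key x)
        above? x = key y <? key x
        pend : Pending partial (filter above? (neighbours y))
        pend = record
          { complete = complete
          ; bounded = λ p → <⇒≤ (bounded p)
          ; unique = Unique.filter⁺ above? (neighbours-unique y)
          ; todo = λ x∈ → let (x∈N , y<x) = ∈-filter⁻ above? x∈ in
              ∈-neighbours⁻ x∈N , y<x , λ p → <-irrefl refl (bounded p)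
          ; done = λ yx y<x → inj₁ (∈-filter⁺ above? (∈-neighbours⁺ yx) y<x)
          ; others = λ _ → free
          }

    descend : ∀ m → Stage (suc m) → Stage m
    descend m st with any? (λ y → key y ℕ.≟ m)
    ... | yes (y , refl) = addVertex y st
    -- Keys need not be consecutive: at a value taken by no vertex the colouring passes through
    -- unchanged.
    ... | no none = record
      { partial = partial
      ; complete = λ uv m≤u m≤v → complete uv (above m≤u) (above m≤v)
      ; bounded = λ p → <⇒≤ (bounded p)
      ; free = free
      }
      where
      open Stage st
      above : ∀ {u} → m ≤ key u → m < key u
      above m≤u = ≤∧≢⇒< m≤u (λ e → none (_ , ≡-sym e))

    descendToZero : ∀ m → Stage m → Stage 0
    descendToZero zero st    = st
    descendToZero (suc m) st = descendToZero m (descend m st)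

    finalStage : ∀ m → (∀ v → key v < m) → Stage 0
    finalStage m key<m = descendToZero m record
      { partial = empty
      ; complete = λ {u} _ m≤u → contradiction m≤u (<⇒≱ (key<m u))
      ; bounded = λ ()
      ; free = λ ()
      }

  -- The vertex order: degree, then index, as two digits in base `n G`.

  key : V → ℕ
  key v = deg G v * n G + toℕ v

  deg<⇒key<* : ∀ {u d} → deg G u < d → key u < d * n G
  deg<⇒key<* {u} {d} du<d = begin-strict
    deg G u * n G + toℕ u  <⟨ +-monoʳ-< (deg G u * n G) (toℕ<n u) ⟩
    deg G u * n G + n G    ≡⟨ +-comm (deg G u * n G) (n G) ⟩
    suc (deg G u) * n G    ≤⟨ *-monoˡ-≤ (n G) du<d ⟩
    d * n G                ∎
    where
    open ≤-Reasoning

  deg<⇒key< : ∀ {u v} → deg G u < deg G v → key u < key v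
  deg<⇒key< {u} {v} du<dv = ≤-trans (deg<⇒key<* du<dv) (m≤m+n (deg G v * n G) (toℕ v))

  key-injective : ∀ {u v} → key u ≡ key v → u ≡ v
  key-injective {u} {v} e with <-cmp (deg G u) (deg G v)
  ... | tri< lt _ _ = contradiction (deg<⇒key< lt) (<-irrefl e)
  ... | tri> _ _ gt = contradiction (deg<⇒key< gt) (<-irrefl (≡-sym e))
  ... | tri≈ _ eq _ = toℕ-injective (+-cancelˡ-≡ (deg G v * n G) (toℕ u) (toℕ v)
    (trans (cong (λ d → d * n G + toℕ u) (≡-sym eq)) e))

  key<⇒deg≤ : ∀ {u v} → key u < key v → deg G u ≤ deg G v
  key<⇒deg≤ u<v = ≮⇒≥ (λ dv<du → <-asym u<v (deg<⇒key< dv<du))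

  -- From a completed partial colouring to an edge colouring.

  module _ {k : ℕ} (P : Partial k) (total : ∀ {u v} → Adj G u v → Coloured P u v) where

    -- If S(v) lay in S(u), it would miss `b`, so the distinct colours of the edges at `v` would all
    -- lie in S(u) without `b`, forcing `deg G v < deg G u`.
    escapes-converse : ∀ {u v} → deg G u ≤ deg G v → Escapes P u v → Escapes P v u
    escapes-converse {u} {v} du≤dv (b , b∈u , b∉v) =
      decidable-stable (escapes? P v u) λ ¬esc → <⇒≱ (few (v⊆u ¬esc)) du≤dv
      where
      rest : List (Fin k)
      rest = filter (λ a → ¬? (a ≟ b)) (colours P u)
      v⊆u : ¬ Escapes P v u → ∀ {a} → Palette P v a → Palette P u a
      v⊆u ¬esc {a} a∈v = decidable-stable (palette? P u a) (λ a∉u → ¬esc (a , a∈v , a∉u))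
      few : (∀ {a} → Palette P v a → Palette P u a) → deg G v < deg G u
      few sub = begin-strict
        deg G v                ≡⟨ length-neighbours v ⟨
        length (neighbours v)  ≤⟨ pigeonhole-length (λ w a → at P v w ≡ just a) (at-proper P) (neighbours-unique v) image ⟩
        length rest            <⟨ filter-notAll (λ a → ¬? (a ≟ b)) (colours P u)
                                    (Any-map (λ { refl a≢b → a≢b refl }) (∈-colours⁺ P b∈u)) ⟩
        length (colours P u)   ≤⟨ length-colours P u ⟩
        deg G u                ∎
        where
        open ≤-Reasoning
        image : ∀ {w} → w ∈ neighbours v → ∃[ a ] a ∈ rest × at P v w ≡ just a
        image w∈ with total (∈-neighbours⁻ w∈)
        ... | a , e = a , ∈-filter⁺ (λ a → ¬? (a ≟ b)) (∈-colours⁺ P (sub (_ , e))) (λ { refl → b∉v (_ , e) }) , e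

    toEdgeColouring : EdgeColouring G k
    toEdgeColouring = record
      { col = λ u v p → proj₁ (total p)
      ; col-sym = λ u v p q → just-injective (trans (≡-sym (proj₂ (total p))) (trans (at-sym P u v) (proj₂ (total q))))
      }

    toEdgeColouring-proper : Proper G toEdgeColouring
    toEdgeColouring-proper u v w p q v≢w e =
      v≢w (at-proper P (proj₂ (total p)) (trans (proj₂ (total q)) (cong just (≡-sym e))))

    palette⇒InPalette : ∀ {v a} → Palette P v a → InPalette G toEdgeColouring v a
    palette⇒InPalette (u , e) = u , at-adj P e , just-injective (trans (≡-sym (proj₂ (total (at-adj P e)))) e)

    InPalette⇒palette : ∀ {v a} → InPalette G toEdgeColouring v a → Palette P v a
    InPalette⇒palette (u , p , refl) = u , proj₂ (total p)

    escapes⇒⊈ : ∀ {u v} → Escapes P u v → ¬ PaletteSubset G toEdgeColouring u v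
    escapes⇒⊈ (a , a∈u , a∉v) sub = a∉v (InPalette⇒palette (sub a (palette⇒InPalette a∈u)))

    -- Minimum degree two enters here: the invariant applies at every vertex of the completed
    -- colouring.
    branching : ∀ {u} → 2 ≤ deg G u → Branching P u
    branching {u} 2≤d with neighbours u in eq | subst (2 ≤_) (≡-sym (length-neighbours u)) 2≤d
    ... | [] | ()
    ... | _ ∷ [] | s≤s ()
    ... | v ∷ w ∷ _ | _ = v , w , v≢w (subst Unique eq (neighbours-unique u)) ,
        total (∈-neighbours⁻ (subst (v ∈_) (≡-sym eq) (here refl))) ,
        total (∈-neighbours⁻ (subst (w ∈_) (≡-sym eq) (there (here refl))))
      where
      v≢w : ∀ {v w ws} → Unique (v ∷ w ∷ ws) → v ≢ w
      v≢w ((v≢w ∷ _) ∷ _) = v≢w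

theorem9 : (G : Graph) (δ Δ : ℕ) → MinDegree G δ → MaxDegree G Δ → 2 ≤ δ →
    InclusionChromaticIndex≤ G (3 * Δ ∸ 1)
theorem9 G δ Δ (δ≤deg , v₀ , _) (deg≤Δ , _) 2≤δ = go Δ deg≤Δ (≤-trans 2≤δ (≤-trans (δ≤deg v₀) (deg≤Δ v₀)))
  where
  go : ∀ Δ → (∀ v → deg G v ≤ Δ) → 2 ≤ Δ → InclusionChromaticIndex≤ G (3 * Δ ∸ 1)
  go (suc Δ₁) deg≤ (s≤s 1≤Δ₁) =
    toEdgeColouring G partial total , toEdgeColouring-proper G partial total , inclusionFree
    where
    enough : Δ₁ + Δ₁ + suc Δ₁ < 3 * suc Δ₁ ∸ 1
    -- With Δ = `Δ₁ + 1`, at most 3`Δ₁` + 1 colours are forbidden at a step, while 3Δ - 1 = 3`Δ₁` +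
    -- 2 are available: one is left.
    enough = ≤-reflexive (solve 1 (λ d → con 1 :+ (d :+ d :+ (con 1 :+ d)) := d :+ ((con 1 :+ d) :+ ((con 1 :+ d) :+ con 0))) refl Δ₁)
      where
      open +-*-Solver
    open Greedy G Δ₁ _ 1≤Δ₁ deg≤ enough (key G) (key-injective G)
    -- Degrees are below `Δ₁ + 2`, so this start lies above every key.
    open Stage (finalStage (suc (suc Δ₁) * n G) (λ v → deg<⇒key<* G (s≤s (deg≤ v))))
    total : ∀ {u v} → Adj G u v → Coloured G partial u v
    total uv = complete uv z≤n z≤n
    escapes-up : ∀ {u v} → Adj G u v → key G u < key G v → Escapes G partial u v
    escapes-up {u} uv u<v = free (total uv) u<v (branching G partial total (≤-trans 2≤δ (δ≤deg u)))
    escapes-down : ∀ {u v} → Adj G u v → key G u < key G v → Escapes G partial v u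
    escapes-down uv u<v = escapes-converse G partial total (key<⇒deg≤ G u<v) (escapes-up uv u<v)
    inclusionFree : ∀ u v → Adj G u v →
      ¬ PaletteSubset G (toEdgeColouring G partial total) u v ×
      ¬ PaletteSubset G (toEdgeColouring G partial total) v u
    inclusionFree u v uv with <-cmp (key G u) (key G v)
    ... | tri< u<v _ _ = escapes⇒⊈ G partial total (escapes-up uv u<v) , escapes⇒⊈ G partial total (escapes-down uv u<v)
    ... | tri> _ _ v<u = escapes⇒⊈ G partial total (escapes-down (Adj-sym G uv) v<u) , escapes⇒⊈ G partial total (escapes-up (Adj-sym G uv) v<u)
    ... | tri≈ _ e _   = contradiction (subst (Adj G u) (≡-sym (key-injective G e)) uv) (Adj-irrefl G)
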